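{- There is an absolute constant $C$ such that for every integer $m\ge1$ and every $T\in\mathbb{Z}_2^m$, the function $f:(\mathbb{Z}_2^m)^3\to\{0,1\}$ given by $f(x,y,z)=1$ if and only if $x+y+z=T$ satisfies $$\chi_3(f)\le C\,m\,2^{m/2}.$$
   Context: In a product $X_1\times X_2\times X_3$ (here each factor is $\mathbb{Z}_2^m$), a cylinder in dimension $i$ is a subset closed under arbitrary changes of the $i$-th coordinate, and a cylinder intersection is a set $T_1\cap T_2\cap T_3$ with $T_i$ a cylinder in dimension $i$. $\chi_3(f)$ is the least number of cylinder intersections, each contained in $f^{ -1}(1)$, whose union is $f^{ -1}(1)$. -}

module Defs where

open import Data.Bool using (Bool; true; _xor_)
open import Data.Bool.Properties using () renaming (_≟_ to _≟ᵇ_)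
open import Data.Fin using (Fin)
open import Data.Nat using (ℕ; _*_; _^_; _≤_)
open import Data.Product using (_×_; _,_; ∃-syntax; Σ-syntax)
open import Data.Vec using (Vec; zipWith)
open import Data.Vec.Properties using (≡-dec)
open import Function.Bundles using (_⇔_)
open import Relation.Binary.PropositionalEquality using (_≡_)
open import Relation.Nullary using (does)

infix 4 _∈_ _⊆_ _≤_·√_

-- Subsets are given by {0,1}-valued indicator functions (true = 1), so a
-- function f : X → Bool is identified with the set f⁻¹(1).
Subset : Set → Set
Subset X = X → Bool

_∈_ : {X : Set} → X → Subset X → Set
x ∈ S = S x ≡ true

_⊆_ : {X : Set} → Subset X → Subset X → Set
S ⊆ S′ = ∀ p → p ∈ S → p ∈ S′

module _ {X₁ X₂ X₃ : Set} where

  IsCylinder₁ : Subset (X₁ × X₂ × X₃) → Set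
  IsCylinder₁ T = ∀ x x′ y z → (x , y , z) ∈ T → (x′ , y , z) ∈ T

  IsCylinder₂ : Subset (X₁ × X₂ × X₃) → Set
  IsCylinder₂ T = ∀ x y y′ z → (x , y , z) ∈ T → (x , y′ , z) ∈ T

  IsCylinder₃ : Subset (X₁ × X₂ × X₃) → Set
  IsCylinder₃ T = ∀ x y z z′ → (x , y , z) ∈ T → (x , y , z′) ∈ T

  IsCylinderIntersection : Subset (X₁ × X₂ × X₃) → Set
  IsCylinderIntersection S =
    ∃[ T₁ ] ∃[ T₂ ] ∃[ T₃ ]
      IsCylinder₁ T₁ × IsCylinder₂ T₂ × IsCylinder₃ T₃ ×
      (∀ p → p ∈ S ⇔ (p ∈ T₁ × p ∈ T₂ × p ∈ T₃))

  -- Repetitions in the family are allowed; this does not affect the least k.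
  CoverableBy : ℕ → (X₁ × X₂ × X₃ → Bool) → Set
  CoverableBy k f =
    Σ[ S ∈ (Fin k → Subset (X₁ × X₂ × X₃)) ]
      (∀ i → IsCylinderIntersection (S i)) ×
      (∀ i → S i ⊆ f) ×
      (∀ p → p ∈ f → ∃[ i ] p ∈ S i)

  infix 4 χ₃_IsEqualTo_

  -- The graph of χ₃: χ₃ f IsEqualTo k pins down k uniquely.
  χ₃_IsEqualTo_ : (X₁ × X₂ × X₃ → Bool) → ℕ → Set
  χ₃ f IsEqualTo k = CoverableBy k f × (∀ j → CoverableBy j f → k ≤ j)

ℤ₂^ : ℕ → Set
ℤ₂^ m = Vec Bool m

infixl 6 _⊕_

_⊕_ : ∀ {m} → ℤ₂^ m → ℤ₂^ m → ℤ₂^ m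
_⊕_ = zipWith _xor_

sumEquals : ∀ {m} → ℤ₂^ m → ℤ₂^ m × ℤ₂^ m × ℤ₂^ m → Bool
sumEquals T (x , y , z) = does (≡-dec _≟ᵇ_ (x ⊕ y ⊕ z) T)

-- The real inequality k ≤ a √b, squared (both sides are nonnegative).
_≤_·√_ : ℕ → ℕ → ℕ → Set
k ≤ a ·√ b = k ^ 2 ≤ a ^ 2 * b

{-# OPTIONS --safe #-}

-- Parametrise f⁻¹(1) by pairs (x , y), the third coordinate being x + y + T.  A cylinder
-- intersection S contains (x , y , z) as soon as it contains (x′ , y , z), (x , y′ , z) and
-- (x , y , z′), so covers of f⁻¹(1) by k cylinder intersections contained in it amount to
-- k-colourings of (ℤ₂^m)² without monochromatic corners (x , y), (x + d , y), (x , y + d), d ≠ 0.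
-- Cut vectors into pairs of bits.  The colouring (x , y) ↦ (xᵢ,₂ + yᵢ,₁)ᵢ is linear, and along
-- a monochromatic corner the first leg gives dᵢ,₂ = 0, the second one dᵢ,₁ = 0; it uses
-- 2^⌈m/2⌉ colours.  The exact value χ₃(f) exists because there are finitely many colourings.
module Submission where

open import Data.Bool using (true; false; _∧_; _xor_)
open import Data.Bool.Properties using (xor-comm) renaming (_≟_ to _≟ᵇ_)
open import Data.Fin using (Fin; finToFun; funToFin)
open import Data.Fin.Properties using (2↔Bool; *↔×; all?; any?; finToFun-funToFin)
  renaming (_≟_ to _≟ᶠ_)
open import Data.Nat using (ℕ; zero; suc; _*_; _^_; _≤_; z≤n; s≤s; ⌈_/2⌉)
open import Data.Nat.Properties
  using (≤-refl; m≤m*n; *-monoˡ-≤; *-monoʳ-≤; ^-monoˡ-≤; ^-monoʳ-≤; ^-*-assoc;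
         module ≤-Reasoning)
open import Data.Product using (_×_; _,_; proj₁; proj₂; ∃-syntax; uncurry)
open import Data.Product.Function.NonDependent.Propositional using (_×-↔_)
open import Data.Vec using ([]; _∷_; head; tail)
open import Data.Vec.Properties using (≡-dec; zipWith-comm; ∷-injective)
open import Function.Base using (_∘_)
open import Function.Bundles using (_↔_; _⇔_; mk↔ₛ′; mk⇔; Injection; Inverse; Equivalence)
open import Function.Properties.Inverse using (↔-sym; ↔-trans; ↔⇒↣)
open import Relation.Binary.PropositionalEquality
  using (_≡_; refl; sym; trans; cong; cong₂; subst; _≗_; module ≡-Reasoning)
open import Relation.Nullary using (Dec; yes; no; does; contradiction)
open import Relation.Nullary.Decidable using (map′; dec-true; _→-dec_)
open import Relation.Unary using (Decidable)
open import Defs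

-- Least witnesses and exhaustive search over finite types.

least : (P : ℕ → Set) → Decidable P → ∀ n → P n →
        ∃[ k ] (P k × (∀ j → P j → k ≤ j))
least P P? n       p with P? zero
least P P? n       p | yes p₀ = zero , p₀ , λ _ _ → z≤n
least P P? zero    p | no ¬p₀ = contradiction p ¬p₀
least P P? (suc n) p | no ¬p₀ with least (P ∘ suc) (P? ∘ suc) n p
... | k , pk , min = suc k , pk , λ where
  zero    p₀ → contradiction p₀ ¬p₀
  (suc j) pj → s≤s (min j pj)

does⇒ : ∀ {P : Set} (P? : Dec P) → does P? ≡ true → P
does⇒ (yes p) refl = p

∧-true : ∀ a b → a ∧ b ≡ true → a ≡ true × b ≡ true
∧-true true true refl = refl , refl

module _ {A : Set} {n : ℕ} (A↔ : A ↔ Fin n) where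
  open Inverse A↔

  finite-all? : {P : A → Set} → Decidable P → Dec (∀ a → P a)
  finite-all? {P} P? = map′ (λ h a → subst P (strictlyInverseʳ a) (h (to a)))
                            (λ h i → h (from i))
                            (all? (P? ∘ from))

  -- Functions are enumerated by their codes below `k ^ n`. Decoding a code recovers the function
  -- only pointwise, so `resp` stands in for function extensionality.
  finite-function-any? : ∀ {k} {P : (A → Fin k) → Set} →
                         (∀ {f g} → f ≗ g → P f → P g) → Decidable P → Dec (∃[ f ] P f)
  finite-function-any? {k} {P} resp P? =
    map′ (λ (i , p) → decode i , p)
         (λ (f , p) → funToFin (f ∘ from) , resp (decoded f) p)
         (any? (P? ∘ decode))
    where
    decode : Fin (k ^ n) → A → Fin k
    decode i a = finToFun i (to a)

    decoded : ∀ f → f ≗ decode (funToFin (f ∘ from))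
    decoded f a = sym (trans (finToFun-funToFin (f ∘ from) (to a))
                             (cong f (strictlyInverseʳ a)))

ℤ₂^-finite : ∀ m → ℤ₂^ m ↔ Fin (2 ^ m)
ℤ₂^-finite zero    = mk↔ₛ′ (λ _ → Fin.zero) (λ _ → []) (λ { Fin.zero → refl ; (Fin.suc ()) }) (λ { [] → refl })
ℤ₂^-finite (suc m) =
  ↔-trans (mk↔ₛ′ (λ v → head v , tail v) (uncurry _∷_) (λ _ → refl) (λ { (_ ∷ _) → refl }))
 (↔-trans (↔-sym 2↔Bool ×-↔ ℤ₂^-finite m)
          (↔-sym *↔×))

-- Bitwise addition and corner-free colourings.

⊕-comm : ∀ {m} (u v : ℤ₂^ m) → u ⊕ v ≡ v ⊕ u
⊕-comm = zipWith-comm xor-comm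

xor-involutiveˡ : ∀ a b → a xor (a xor b) ≡ b
xor-involutiveˡ false b     = refl
xor-involutiveˡ true  false = refl
xor-involutiveˡ true  true  = refl

xor-cancelˡ : ∀ a {b c} → a xor b ≡ a xor c → b ≡ c
xor-cancelˡ a {b} {c} eq =
  trans (sym (xor-involutiveˡ a b)) (trans (cong (a xor_) eq) (xor-involutiveˡ a c))

xor-cancelʳ : ∀ c {a b} → a xor c ≡ b xor c → a ≡ b
xor-cancelʳ c {a} {b} eq = xor-cancelˡ c (trans (xor-comm c a) (trans eq (xor-comm b c)))

⊕-involutiveˡ : ∀ {m} (u v : ℤ₂^ m) → u ⊕ (u ⊕ v) ≡ v
⊕-involutiveˡ []      []      = refl
⊕-involutiveˡ (a ∷ u) (b ∷ v) = cong₂ _∷_ (xor-involutiveˡ a b) (⊕-involutiveˡ u v)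

⊕-involutiveʳ : ∀ {m} (u v : ℤ₂^ m) → (u ⊕ v) ⊕ v ≡ u
⊕-involutiveʳ u v = trans (⊕-comm (u ⊕ v) v) (trans (cong (v ⊕_) (⊕-comm u v)) (⊕-involutiveˡ v u))

⊕-cancelʳ : ∀ {m} (w : ℤ₂^ m) {u v} → u ⊕ w ≡ v ⊕ w → u ≡ v
⊕-cancelʳ w {u} {v} eq =
  trans (sym (⊕-involutiveʳ u w)) (trans (cong (_⊕ w) eq) (⊕-involutiveʳ v w))

-- With d = x ⊕ x′ the hypothesis x′ ⊕ y ≡ x ⊕ y′ says that y′ ≡ y ⊕ d.
CornerFree : ∀ {m} {A : Set} → (ℤ₂^ m × ℤ₂^ m → A) → Set
CornerFree c = ∀ x x′ y y′ → x′ ⊕ y ≡ x ⊕ y′ →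
               c (x′ , y) ≡ c (x , y) → c (x , y′) ≡ c (x , y) → x ≡ x′

cornerFree-resp : ∀ {m} {A : Set} {c d : ℤ₂^ m × ℤ₂^ m → A} →
                  c ≗ d → CornerFree c → CornerFree d
cornerFree-resp c≗d free x x′ y y′ eq e₁ e₂ =
  free x x′ y y′ eq (trans (c≗d _) (trans e₁ (sym (c≗d _))))
                    (trans (c≗d _) (trans e₂ (sym (c≗d _))))

cornerFree? : ∀ {m k} → Decidable (CornerFree {m} {Fin k})
cornerFree? {m} c =
  every λ x → every λ x′ → every λ y → every λ y′ →
    x′ ⊕ y ≟ x ⊕ y′ →-dec
    (c (x′ , y) ≟ᶠ c (x , y) →-dec (c (x , y′) ≟ᶠ c (x , y) →-dec x ≟ x′))
  where
  infix 5 _≟_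
  _≟_ = ≡-dec {n = m} _≟ᵇ_
  every : {P : ℤ₂^ m → Set} → Decidable P → Dec (∀ x → P x)
  every = finite-all? (ℤ₂^-finite m)

cornerFreeColouring? : ∀ m k → Dec (∃[ c ] CornerFree {m} {Fin k} c)
cornerFreeColouring? m k =
  finite-function-any? (↔-trans (ℤ₂^-finite m ×-↔ ℤ₂^-finite m) (↔-sym *↔×))
                       cornerFree-resp cornerFree?

-- Covers versus corner-free colourings.

module _ {m : ℕ} (T : ℤ₂^ m) where

  sumEquals⇒ : ∀ {x y z} → (x , y , z) ∈ sumEquals T → x ⊕ y ⊕ z ≡ T
  sumEquals⇒ = does⇒ (≡-dec _≟ᵇ_ _ T)

  ⇒sumEquals : ∀ {x y z} → x ⊕ y ⊕ z ≡ T → (x , y , z) ∈ sumEquals T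
  ⇒sumEquals = dec-true (≡-dec _≟ᵇ_ _ T)

  cover⇒colouring : ∀ {k} → CoverableBy k (sumEquals T) → ∃[ c ] CornerFree {m} {Fin k} c
  cover⇒colouring {k} (S , cyl , S⊆f , covers) = c , free
    where
    covered : ∀ x y → ∃[ i ] (x , y , x ⊕ y ⊕ T) ∈ S i
    covered x y = covers _ (⇒sumEquals (⊕-involutiveˡ (x ⊕ y) T))

    c : ℤ₂^ m × ℤ₂^ m → Fin k
    c (x , y) = proj₁ (covered x y)

    free : CornerFree c
    free x x′ y y′ eq e₁ e₂ with cyl (c (x , y))
    ... | T₁ , T₂ , T₃ , cyl₁ , cyl₂ , cyl₃ , S⇔ =
      -- The centre `(x , y , z)` lies in `S i`, hence in the set where the sum is `T`; by the
      -- choice of `z`, so does `(x′ , y , z)`. Cancelling gives `x ≡ x′`.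
      ⊕-cancelʳ y (⊕-cancelʳ z (trans (sumEquals⇒ (S⊆f i _ p∈S)) (sym (⊕-involutiveˡ (x′ ⊕ y) T))))
      where
      i = c (x , y)
      -- The third coordinate of both legs: by `eq` it also equals `x ⊕ y′ ⊕ T`.
      z = x′ ⊕ y ⊕ T

      p₁∈S : (x′ , y , z) ∈ S i
      p₁∈S = subst (λ j → (x′ , y , z) ∈ S j) e₁ (proj₂ (covered x′ y))

      p₂∈S : (x , y′ , z) ∈ S i
      p₂∈S = subst (λ w → (x , y′ , w ⊕ T) ∈ S i) (sym eq)
               (subst (λ j → (x , y′ , x ⊕ y′ ⊕ T) ∈ S j) e₂ (proj₂ (covered x y′)))

      inS : ∀ {p} → p ∈ S i → p ∈ T₁ × p ∈ T₂ × p ∈ T₃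
      inS = Equivalence.to (S⇔ _)

      p∈S : (x , y , z) ∈ S i
      p∈S = Equivalence.from (S⇔ _)
        ( cyl₁ x′ x y z (proj₁ (inS p₁∈S))
        , cyl₂ x y′ y z (proj₁ (proj₂ (inS p₂∈S)))
        , cyl₃ x y _ z (proj₂ (proj₂ (inS (proj₂ (covered x y))))))

  colouring⇒cover : ∀ {k} → ∃[ c ] CornerFree {m} {Fin k} c → CoverableBy k (sumEquals T)
  colouring⇒cover {k} (c , free) = S , cyl , S⊆f , covers
    where
    T₁ T₂ T₃ S : Fin k → Subset (ℤ₂^ m × ℤ₂^ m × ℤ₂^ m)
    -- Each test replaces one coordinate by the value that makes the sum `T` and reads the colour
    -- there. It ignores the replaced coordinate, so the cylinder conditions hold definitionally.
    T₁ i (x , y , z) = does (c (z ⊕ T ⊕ y , y) ≟ᶠ i)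
    T₂ i (x , y , z) = does (c (x , x ⊕ (z ⊕ T)) ≟ᶠ i)
    T₃ i (x , y , z) = does (c (x , y) ≟ᶠ i)
    S i p = T₁ i p ∧ (T₂ i p ∧ T₃ i p)

    S⇔ : ∀ i p → p ∈ S i ⇔ (p ∈ T₁ i × p ∈ T₂ i × p ∈ T₃ i)
    S⇔ i p = mk⇔
      (λ s → let t₁ , t = ∧-true (T₁ i p) _ s in t₁ , ∧-true (T₂ i p) _ t)
      (λ (t₁ , t₂ , t₃) → cong₂ _∧_ t₁ (cong₂ _∧_ t₂ t₃))

    cyl : ∀ i → IsCylinderIntersection (S i)
    cyl i = T₁ i , T₂ i , T₃ i , (λ _ _ _ _ t → t) , (λ _ _ _ _ t → t) , (λ _ _ _ _ t → t) , S⇔ i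

    S⊆f : ∀ i → S i ⊆ sumEquals T
    S⊆f i p@(x , y , z) s with Equivalence.to (S⇔ i p) s
    ... | t₁ , t₂ , t₃ = ⇒sumEquals (begin
        x ⊕ y ⊕ z              ≡⟨ cong (λ v → v ⊕ y ⊕ z) x≡x′ ⟩
        z ⊕ T ⊕ y ⊕ y ⊕ z      ≡⟨ cong (_⊕ z) (⊕-involutiveʳ (z ⊕ T) y) ⟩
        z ⊕ T ⊕ z              ≡⟨ cong (_⊕ z) (⊕-comm z T) ⟩
        T ⊕ z ⊕ z              ≡⟨ ⊕-involutiveʳ T z ⟩
        T                      ∎)
      where
      open ≡-Reasoning
      colour : ∀ {a b} → does (a ≟ᶠ i) ≡ true → does (b ≟ᶠ i) ≡ true → a ≡ b
      colour s t = trans (does⇒ (_ ≟ᶠ i) s) (sym (does⇒ (_ ≟ᶠ i) t))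

      -- The three tests say that a corner based at `(x , y)` is monochromatic; it must therefore be
      -- degenerate.
      x≡x′ : x ≡ z ⊕ T ⊕ y
      x≡x′ = free x (z ⊕ T ⊕ y) y (x ⊕ (z ⊕ T))
        (trans (⊕-involutiveʳ (z ⊕ T) y) (sym (⊕-involutiveˡ x (z ⊕ T))))
        (colour t₁ t₃) (colour t₂ t₃)

    covers : ∀ p → p ∈ sumEquals T → ∃[ i ] p ∈ S i
    -- When the sum is already `T`, the replacements change nothing and all three tests read the
    -- colour of `(x , y)`.
    covers p@(x , y , z) p∈f = c (x , y) , Equivalence.from (S⇔ _ p)
      ( dec-true (_ ≟ᶠ _) (cong (λ v → c (v , y)) x′≡x)
      , dec-true (_ ≟ᶠ _) (cong (λ v → c (x , v)) y′≡y)
      , dec-true (c (x , y) ≟ᶠ _) refl)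
      where
      z⊕T : z ⊕ T ≡ x ⊕ y
      z⊕T = trans (cong (z ⊕_) (trans (sym (sumEquals⇒ p∈f)) (⊕-comm (x ⊕ y) z)))
                  (⊕-involutiveˡ z (x ⊕ y))

      x′≡x : z ⊕ T ⊕ y ≡ x
      x′≡x = trans (cong (_⊕ y) z⊕T) (⊕-involutiveʳ x y)

      y′≡y : x ⊕ (z ⊕ T) ≡ y
      y′≡y = trans (cong (x ⊕_) z⊕T) (⊕-involutiveˡ x y)

  -- Passing to colourings turns the search over families of subsets with their cylinder witnesses
  -- into a search over functions between finite types.
  coverable? : ∀ k → Dec (CoverableBy k (sumEquals T))
  coverable? k = map′ colouring⇒cover cover⇒colouring (cornerFreeColouring? m k)

-- The colouring by pairs of bits.

hue : ∀ {m} → ℤ₂^ m × ℤ₂^ m → ℤ₂^ ⌈ m /2⌉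
hue ([]          , [])          = []
-- For odd `m` the unpaired last bit of the first argument is a colour bit by itself; the first leg
-- alone then fixes it.
hue (a ∷ []      , b ∷ [])      = a ∷ []
hue (a₁ ∷ a₂ ∷ x , b₁ ∷ b₂ ∷ y) = (a₂ xor b₁) ∷ hue (x , y)

hue-cornerFree : ∀ m → CornerFree (hue {m})
hue-cornerFree zero [] [] [] [] _ _ _ = refl
hue-cornerFree (suc zero) (a ∷ []) (a′ ∷ []) (b ∷ []) (b′ ∷ []) _ e₁ _ = sym e₁
hue-cornerFree (suc (suc m)) (a₁ ∷ a₂ ∷ x) (a₁′ ∷ a₂′ ∷ x′) (b₁ ∷ b₂ ∷ y) (b₁′ ∷ b₂′ ∷ y′) eq e₁ e₂
  with eq₁ , eq′ ← ∷-injective eq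
  with _ , eq″ ← ∷-injective eq′
  with h₁ , t₁ ← ∷-injective e₁
  with h₂ , t₂ ← ∷-injective e₂ =
  cong₂ _∷_ a₁≡a₁′ (cong₂ _∷_ a₂≡a₂′ (hue-cornerFree m x x′ y y′ eq″ t₁ t₂))
  where
  a₂≡a₂′ : a₂ ≡ a₂′
  a₂≡a₂′ = sym (xor-cancelʳ b₁ h₁)

  -- The second leg gives `b₁′ ≡ b₁`, and the corner equation on the first bits transfers this to
  -- `a₁`.
  a₁≡a₁′ : a₁ ≡ a₁′
  a₁≡a₁′ = sym (xor-cancelʳ b₁ (trans eq₁ (cong (a₁ xor_) (xor-cancelˡ a₂ h₂))))

hueColouring : ∀ m → ∃[ c ] CornerFree {m} {Fin (2 ^ ⌈ m /2⌉)} c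
hueColouring m = to ∘ hue , λ x x′ y y′ eq e₁ e₂ →
  hue-cornerFree m x x′ y y′ eq (injective e₁) (injective e₂)
  where open Injection (↔⇒↣ (ℤ₂^-finite ⌈ m /2⌉))

⌈n/2⌉*2≤1+n : ∀ n → ⌈ n /2⌉ * 2 ≤ suc n
⌈n/2⌉*2≤1+n zero          = z≤n
⌈n/2⌉*2≤1+n (suc zero)    = ≤-refl
⌈n/2⌉*2≤1+n (suc (suc n)) = s≤s (s≤s (⌈n/2⌉*2≤1+n n))

corollary28 : ∃[ C ] ((m : ℕ) → 1 ≤ m → (T : ℤ₂^ m) →
    ∃[ k ] (χ₃ (sumEquals T) IsEqualTo k × k ≤ (C * m) ·√ (2 ^ m)))
-- Rounding `m / 2` up costs at most a factor 2 in the squared bound, which the square of the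
-- constant 2 absorbs; the factor `m` enters through `1 ≤ m`.
corollary28 = 2 , bound
  where
  open ≤-Reasoning

  bound : (m : ℕ) → 1 ≤ m → (T : ℤ₂^ m) →
    ∃[ k ] (χ₃ (sumEquals T) IsEqualTo k × k ≤ (2 * m) ·√ (2 ^ m))
  bound m 1≤m T
    with cover ← colouring⇒cover T (hueColouring m)
    with k , coverable , minimal ← least _ (coverable? T) _ cover =
    k , (coverable , minimal) , (begin
      k ^ 2                  ≤⟨ ^-monoˡ-≤ 2 (minimal _ cover) ⟩
      (2 ^ ⌈ m /2⌉) ^ 2      ≡⟨ ^-*-assoc 2 ⌈ m /2⌉ 2 ⟩
      2 ^ (⌈ m /2⌉ * 2)      ≤⟨ ^-monoʳ-≤ 2 (⌈n/2⌉*2≤1+n m) ⟩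
      2 * 2 ^ m              ≤⟨ *-monoˡ-≤ (2 ^ m) (m≤m*n 2 2) ⟩
      2 ^ 2 * 2 ^ m          ≤⟨ *-monoˡ-≤ (2 ^ m) (^-monoˡ-≤ 2 (*-monoʳ-≤ 2 1≤m)) ⟩
      (2 * m) ^ 2 * 2 ^ m    ∎)
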